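{- Let $n\geq 2$ and let $f=1^{x_{1}}0^{y_{1}}1^{x_{2}}0^{y_{2}}\cdots 1^{x_{n}}0^{y_{n}}$ with integers $x_i\geq 1$, $y_i\geq 1$ for $i=1,\ldots,n$. If $x_{1}=1$ and $y_{n}\geq y_{1}+2$, then $Q_{d}(f)\not\hookrightarrow Q_{d}$ for all $d\geq 2\sum_{i=2}^{n}(x_{i}+y_{i})+y_{1}$.
   Context: All strings are binary; $1^a$ (resp. $0^a$) denotes the string of $a$ consecutive ones (resp. zeros), and juxtaposition is concatenation. $Q_d$ is the $d$-dimensional hypercube: its vertices are the binary strings of length $d$, two being adjacent iff they differ in exactly one bit. A string $f$ is a factor of $\mu$ if $f$ appears as $|f|$ consecutive bits of $\mu$. The generalized Fibonacci cube $Q_d(f)$ is the subgraph of $Q_d$ induced by all strings of length $d$ that do not contain $f$ as a factor. A subgraph $H$ of a connected graph $G$ is an isometric subgraph, written $H\hookrightarrow G$ (and $H\not\hookrightarrow G$ otherwise), if $d_H(\mu,\nu)=d_G(\mu,\nu)$ for all $\mu,\nu\in V(H)$ (with $d_H=\infty$ for vertices in different components of $H$). -}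

module Defs where

open import Level using (0ℓ)
open import Data.Bool.Base using (Bool; true; false)
open import Data.Fin.Base using (Fin)
open import Data.List.Base using (List; _++_; concat; replicate; tabulate)
open import Data.List.Relation.Binary.Infix.Heterogeneous using (Infix)
open import Data.Nat.Base using (ℕ; zero; suc; _≤_)
open import Data.Product using (_×_; _,_; ∃!; proj₁; proj₂)
open import Data.Vec.Base using (Vec; lookup; toList)
open import Function.Base using (_∘_)
open import Function.Bundles using (_⇔_)
open import Relation.Binary.Core using (Rel; _⇒_)
open import Relation.Binary.Definitions using (Symmetric; Irreflexive)
open import Relation.Binary.PropositionalEquality using (_≡_; _≢_; refl; sym)
open import Relation.Nullary.Construct.Add.Supremum using (_⁺; [_]; ⊤⁺)
open import Relation.Nullary.Negation.Core using (¬_)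
open import Relation.Unary using (Pred; _⊆_; _∩_; ∁; U)

-- Simple undirected graphs.  The vertex set is a predicate on a carrier A, so
-- that a graph and its subgraphs have vertices of the same type.

record Graph (A : Set) : Set₁ where
  field
    Vertex     : Pred A 0ℓ
    Adj        : Rel A 0ℓ
    adj-vertex : ∀ {u v} → Adj u v → Vertex u
    adj-sym    : Symmetric Adj
    adj-irrefl : Irreflexive _≡_ Adj

open Graph public

module _ {A : Set} where

  infix 4 _⊑_

  record _⊑_ (H G : Graph A) : Set where
    field
      vertex-⊆ : Vertex H ⊆ Vertex G
      adj-⇒    : Adj H ⇒ Adj G

  induced : Graph A → Pred A 0ℓ → Graph A
  induced G P = record
    { Vertex     = Vertex G ∩ P
    ; Adj        = λ u v → Adj G u v × P u × P v
    ; adj-vertex = λ (e , pu , _) → adj-vertex G e , pu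
    ; adj-sym    = λ (e , pu , pv) → adj-sym G e , pv , pu
    ; adj-irrefl = λ u≡v (e , _) → adj-irrefl G u≡v e
    }

  induced-⊑ : (G : Graph A) (P : Pred A 0ℓ) → induced G P ⊑ G
  induced-⊑ G P = record { vertex-⊆ = proj₁ ; adj-⇒ = proj₁ }

  data Walk (G : Graph A) : A → A → ℕ → Set where
    nil  : ∀ {u} → Vertex G u → Walk G u u zero
    cons : ∀ {u v w k} → Adj G u v → Walk G v w k → Walk G u w (suc k)

  -- Distance G u v δ says d_G(u,v) = δ, where ⊤⁺ plays the role of ∞.
  Distance : Graph A → A → A → ℕ ⁺ → Set
  Distance G u v [ k ] = Walk G u v k × (∀ j → Walk G u v j → k ≤ j)
  Distance G u v ⊤⁺    = ∀ j → ¬ Walk G u v j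

  -- Distances are relations here, so d_H(u,v) = d_G(u,v) is expressed by both
  -- sides taking the same values.
  Isometric : {H G : Graph A} → H ⊑ G → Set
  Isometric {H} {G} _ =
    ∀ u v → Vertex H u → Vertex H v →
    ∀ δ → Distance H u v δ ⇔ Distance G u v δ

-- Bits: true is 1, false is 0.

Factor : ∀ {d} → List Bool → Pred (Vec Bool d) 0ℓ
Factor f μ = Infix _≡_ f (toList μ)

Q : (d : ℕ) → Graph (Vec Bool d)
Q d = record
  { Vertex     = U
  ; Adj        = λ u v → ∃! _≡_ λ i → lookup u i ≢ lookup v i
  ; adj-vertex = _
  ; adj-sym    = λ (i , u≢v , unique) → i , u≢v ∘ sym , λ v≢u → unique (v≢u ∘ sym)
  ; adj-irrefl = λ { refl (i , u≢u , _) → u≢u refl }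
  }

Q[_] : List Bool → (d : ℕ) → Graph (Vec Bool d)
Q[ f ] d = induced (Q d) (∁ (Factor f))

Q[_]⊑Q : (f : List Bool) (d : ℕ) → Q[ f ] d ⊑ Q d
Q[ f ]⊑Q d = induced-⊑ (Q d) (∁ (Factor f))

-- 1^{x₁} 0^{y₁} ⋯ 1^{xₙ} 0^{yₙ}
blocks : ∀ {n} → (x y : Fin n → ℕ) → List Bool
blocks x y = concat (tabulate λ i → replicate (x i) true ++ replicate (y i) false)

{-# OPTIONS --safe #-}

-- Write f = 1 0^k 1 h with h = t 0^(k+2).  If t is not a zero word, put
-- w a b = 1 0^k 1 t a 0^k b h; if it is, put w a b = 1 0^k 1 a 0^k b h (for
-- f = 1 0^k 1 0^(2k+2) the first choice fails: there f is a factor of w 1 0).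
-- Then w 0 0 starts with f and w 1 1 ends with f, while w 1 0 and w 0 1 avoid f.
-- The latter two are thus at distance 2 in the hypercube, but both of their common
-- neighbours are missing from the subgraph.  Since f starts with 1, prepending
-- zeros to w creates no new occurrence of f, so all larger dimensions follow.
--
-- For the avoidance when t is not zero: w 1 0 and w 0 1 are locally periodic with
-- period |h|, so an occurrence of 1 h starting within the factor 1 t a 0^k would
-- put its last letter 0 on a 1.  The one start in w 1 0 not covered by this, at
-- the flipped letter a, would make h a prefix of 0^(k+1) h, moving its leftmost 1.

module Submission where

open import Defs
open import Data.Bool.Base using (Bool; true; false)
open import Data.Bool.Properties using (_≟_)
open import Data.Fin.Base using (Fin; zero; suc; fromℕ)
import Data.Fin.Properties as Fin
open import Data.List.Base using (List; []; _∷_; _++_; _∷ʳ_; length; replicate; sum; tabulate)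
open import Data.List.Properties
  using (++-assoc; ++-cancelʳ; ++-identityʳ; ∷-injective; ∷-injectiveˡ; ∷-injectiveʳ; ∷ʳ-injectiveʳ;
         length-++; length-replicate)
open import Data.List.Relation.Binary.Infix.Heterogeneous using (Infix; here; there; MkView; toView; _++ⁱ_)
open import Data.List.Relation.Binary.Infix.Heterogeneous.Properties using (length-mono)
open import Data.List.Relation.Binary.Pointwise using (Pointwise-≡⇒≡; ≡⇒Pointwise-≡)
open import Data.List.Relation.Binary.Prefix.Heterogeneous using (Prefix; []; _∷_)
open import Data.List.Relation.Binary.Prefix.Heterogeneous.Properties using (fromPointwise)
open import Data.Nat.Base using (ℕ; zero; suc; _+_; _*_; _≥_; _≤_; s≤s; z≤n)
open import Data.Nat.Properties
  using (suc-injective; +-comm; 1+n≰n; <⇒≱; m≤m+n; m≤n+m; ≤-trans; ≤-reflexive; m≤n⇒∃[o]m+o≡n)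
open import Data.Nat.Tactic.RingSolver using (solve-∀)
open import Data.Product using (_×_; _,_; proj₂; ∃₂; ∃-syntax)
open import Data.Sum.Base using (_⊎_; inj₁; inj₂)
open import Data.Unit.Base using (tt)
open import Data.Vec.Base as Vec using (Vec; fromList; toList)
import Data.Vec.Properties as Vec
open import Function.Base using (_∘_)
open import Function.Bundles using (Equivalence)
open import Relation.Binary.PropositionalEquality
open import Relation.Nullary.Construct.Add.Supremum using ([_])
open import Relation.Nullary.Negation.Core using (¬_; contradiction)
open import Relation.Nullary.Decidable.Core using (yes; no)

private
  variable
    A : Set
    d n : ℕ
    a a′ b b′ : Bool
    f g R : List Bool

-- Adjacency and distance two in the hypercube

Adj-here : {v : Vec Bool n} → a ≢ b → Adj (Q (suc n)) (a Vec.∷ v) (b Vec.∷ v)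
Adj-here a≢b = zero , a≢b , λ { {zero} _ → refl ; {suc _} ≢ → contradiction refl ≢ }

Adj-there : {u v : Vec Bool n} → Adj (Q n) u v → Adj (Q (suc n)) (a Vec.∷ u) (a Vec.∷ v)
Adj-there (i , u≢v , unique) =
  suc i , u≢v , λ { {zero} ≢ → contradiction refl ≢ ; {suc _} ≢ → cong suc (unique ≢) }

Adj-++ : ∀ {m} (P : Vec Bool m) {u v : Vec Bool n} →
         Adj (Q n) u v → Adj (Q (m + n)) (P Vec.++ u) (P Vec.++ v)
Adj-++ Vec.[]      e = e
Adj-++ (_ Vec.∷ P) e = Adj-there (Adj-++ P e)

-- Uniqueness of the flipped index only refutes a difference at any other index; decidability of
-- bits turns this into equality.
lookup-ext : {u v : Vec Bool n} → (∀ i → ¬ (Vec.lookup u i ≢ Vec.lookup v i)) → u ≡ v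
lookup-ext {u = Vec.[]}    {Vec.[]}    _  = refl
lookup-ext {u = a Vec.∷ _} {b Vec.∷ _} eq with a ≟ b
... | yes refl = cong (a Vec.∷_) (lookup-ext (eq ∘ suc))
... | no  a≢b  = contradiction a≢b (eq zero)

Adj-∷⁻ : {u v : Vec Bool n} → Adj (Q (suc n)) (a Vec.∷ u) (b Vec.∷ v) →
         (a ≢ b × u ≡ v) ⊎ (a ≡ b × Adj (Q n) u v)
Adj-∷⁻ (zero , a≢b , unique) =
  inj₁ (a≢b , lookup-ext λ i ≢ → contradiction (unique {suc i} ≢) λ ())
Adj-∷⁻ {a = a} {b} (suc i , u≢v , unique) with a ≟ b
... | yes a≡b = inj₂ (a≡b , i , u≢v , λ ≢ → Fin.suc-injective (unique ≢))
... | no  a≢b = contradiction (unique {zero} a≢b) λ ()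

module _ {m n} (M : Vec Bool m) (N : Vec Bool n) (a≢a′ : a ≢ a′) (b≢b′ : b ≢ b′) where

  private
    tails-≢ : M Vec.++ b Vec.∷ N ≢ M Vec.++ b′ Vec.∷ N
    tails-≢ = b≢b′ ∘ Vec.∷-injectiveˡ ∘ Vec.++-injectiveʳ M M

  two-flips-≢ : ∀ {l} (P : Vec Bool l) →
                P Vec.++ a Vec.∷ M Vec.++ b Vec.∷ N ≢ P Vec.++ a′ Vec.∷ M Vec.++ b′ Vec.∷ N
  two-flips-≢ P = a≢a′ ∘ Vec.∷-injectiveˡ ∘ Vec.++-injectiveʳ P P

  two-flips-¬Adj : ∀ {l} (P : Vec Bool l) →
                   ¬ Adj (Q _) (P Vec.++ a Vec.∷ M Vec.++ b Vec.∷ N)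
                               (P Vec.++ a′ Vec.∷ M Vec.++ b′ Vec.∷ N)
  two-flips-¬Adj (_ Vec.∷ P) e with Adj-∷⁻ e
  ... | inj₁ (c≢c , _) = c≢c refl
  ... | inj₂ (_ , e′)  = two-flips-¬Adj P e′
  two-flips-¬Adj Vec.[] e with Adj-∷⁻ e
  ... | inj₁ (_ , eq)   = tails-≢ eq
  ... | inj₂ (a≡a′ , _) = a≢a′ a≡a′

  -- A step that flips a letter of the common prefix `P` would have to be undone by the other step,
  -- leaving both words equal. So each of the two steps corrects one of the two differing letters,
  -- in either order.
  common-neighbour : ∀ {l} (P : Vec Bool l) {z} →
                     Adj (Q _) (P Vec.++ a Vec.∷ M Vec.++ b Vec.∷ N) z →
                     Adj (Q _) z (P Vec.++ a′ Vec.∷ M Vec.++ b′ Vec.∷ N) →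
                     z ≡ P Vec.++ a′ Vec.∷ M Vec.++ b Vec.∷ N ⊎
                     z ≡ P Vec.++ a Vec.∷ M Vec.++ b′ Vec.∷ N
  common-neighbour (_ Vec.∷ P) {_ Vec.∷ z} e₁ e₂ with Adj-∷⁻ e₁ | Adj-∷⁻ e₂
  ... | inj₁ (_ , refl)   | inj₁ (_ , eq)    = contradiction eq (two-flips-≢ P)
  ... | inj₁ (c≢c , _)    | inj₂ (refl , _)  = contradiction refl c≢c
  ... | inj₂ (refl , _)   | inj₁ (c≢c , _)   = contradiction refl c≢c
  ... | inj₂ (refl , e₁′) | inj₂ (_ , e₂′) with common-neighbour P {z} e₁′ e₂′
  ...   | inj₁ eq = inj₁ (cong (_ Vec.∷_) eq)
  ...   | inj₂ eq = inj₂ (cong (_ Vec.∷_) eq)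
  common-neighbour Vec.[] {_ Vec.∷ _} e₁ e₂ with Adj-∷⁻ e₁ | Adj-∷⁻ e₂
  ... | inj₁ (_ , refl) | inj₁ (_ , eq)      = contradiction eq tails-≢
  ... | inj₁ (_ , refl) | inj₂ (refl , _)    = inj₁ refl
  ... | inj₂ (refl , _) | inj₁ (_ , refl)    = inj₂ refl
  ... | inj₂ (refl , _) | inj₂ (refl , _)    = contradiction refl a≢a′

module _ {l m n} (P : Vec Bool l) (M : Vec Bool m) (N : Vec Bool n) where

  private
    w : Bool → Bool → Vec Bool (l + suc (m + suc n))
    w a b = P Vec.++ a Vec.∷ M Vec.++ b Vec.∷ N

    first-flip : a ≢ a′ → Adj (Q _) (w a b) (w a′ b)
    first-flip {a} {a′} {b} a≢a′ = Adj-++ P {a Vec.∷ v} {a′ Vec.∷ v} (Adj-here {v = v} a≢a′)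
      where
      v : Vec Bool (m + suc n)
      v = M Vec.++ b Vec.∷ N

    second-flip : b ≢ b′ → Adj (Q _) (w a b) (w a b′)
    second-flip {b} {b′} {a} b≢b′ = Adj-++ P {a Vec.∷ M Vec.++ u} {a Vec.∷ M Vec.++ v}
      (Adj-there {u = M Vec.++ u} {M Vec.++ v} (Adj-++ M {u} {v} (Adj-here {v = N} b≢b′)))
      where
      u v : Vec Bool (suc n)
      u = b Vec.∷ N
      v = b′ Vec.∷ N

    10⇝01 : Distance (Q _) (w true false) (w false true) [ 2 ]
    10⇝01 = cons {v = w false false} (first-flip λ ()) (cons (second-flip λ ()) (nil tt))
          , λ j walk → minimal walk refl refl
      where
      -- The endpoints are variables tied by equations, so that the walk can be matched although
      -- `w a b` is not in constructor form.
      minimal : ∀ {j u v} → Walk (Q _) u v j → u ≡ w true false → v ≡ w false true → 2 ≤ j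
      minimal (nil _) eq₁ eq₂ =
        contradiction (trans (sym eq₁) eq₂) (two-flips-≢ M N (λ ()) (λ ()) P)
      minimal (cons e (nil _)) refl refl = contradiction e (two-flips-¬Adj M N (λ ()) (λ ()) P)
      minimal (cons _ (cons _ _)) _ _ = s≤s (s≤s z≤n)

  -- Isometry would give a walk of two edges inside the subgraph. Its middle vertex avoids `f`, yet
  -- it is one of the two common neighbours, which contain `f`.
  critical-pair-Vec :
    Factor f (w false false) → Factor f (w true true) →
    ¬ Factor f (w true false) → ¬ Factor f (w false true) →
    ¬ Isometric (Q[ f ]⊑Q (l + suc (m + suc n)))
  critical-pair-Vec f∈00 f∈11 f∉10 f∉01 iso
    with Equivalence.from (iso _ _ (tt , f∉10) (tt , f∉01) [ 2 ]) 10⇝01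
  ... | cons {v = z} (e₁ , _ , f∉z) (cons (e₂ , _) (nil _)) , _
    with common-neighbour M N (λ ()) (λ ()) P {z} e₁ e₂
  ...   | inj₁ refl = f∉z f∈00
  ...   | inj₂ refl = f∉z f∈11

-- Factors of words

0^_ : ℕ → List Bool
0^ n = replicate n false

-- The pattern begins with 1, so no occurrence starts on a leading zero.
skip-zeros : ∀ n → Infix _≡_ (true ∷ f) (0^ n ++ R) → Infix _≡_ (true ∷ f) R
skip-zeros zero    i         = i
skip-zeros (suc n) (here (() ∷ _))
skip-zeros (suc n) (there i) = skip-zeros n i

toList-word : ∀ P M N → toList (fromList P Vec.++ a Vec.∷ fromList M Vec.++ b Vec.∷ fromList N)
                        ≡ P ++ a ∷ M ++ b ∷ N
toList-word {a} {b} P M N = trans (Vec.toList-++ (fromList P) _)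
  (cong₂ (λ u v → u ++ a ∷ v) (Vec.toList∘fromList P) (trans (Vec.toList-++ (fromList M) _)
    (cong₂ (λ u v → u ++ b ∷ v) (Vec.toList∘fromList M) (Vec.toList∘fromList N))))

-- The surplus dimension `o` is filled with zeros in front of `P`. This keeps existing occurrences
-- and, by `skip-zeros`, creates none.
critical-pair : ∀ P M N → let w = λ a b → P ++ a ∷ M ++ b ∷ N in
  Infix _≡_ (true ∷ f) (w false false) → Infix _≡_ (true ∷ f) (w true true) →
  ¬ Infix _≡_ (true ∷ f) (w true false) → ¬ Infix _≡_ (true ∷ f) (w false true) →
  length P + suc (length M + suc (length N)) ≤ d →
  ¬ Isometric (Q[ true ∷ f ]⊑Q d)
critical-pair {f} P M N f∈00 f∈11 f∉10 f∉01 ≤d with o , refl ← m≤n⇒∃[o]m+o≡n ≤d =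
  subst (λ d → ¬ Isometric (Q[ true ∷ f ]⊑Q d)) dimension
    (critical-pair-Vec (fromList (0^ o ++ P)) (fromList M) (fromList N)
      (pad f∈00) (pad f∈11) (f∉10 ∘ unpad) (f∉01 ∘ unpad))
  where
  padded : ∀ {a b} →
    toList (fromList (0^ o ++ P) Vec.++ a Vec.∷ fromList M Vec.++ b Vec.∷ fromList N)
    ≡ 0^ o ++ P ++ a ∷ M ++ b ∷ N
  padded = trans (toList-word (0^ o ++ P) M N) (++-assoc (0^ o) P _)

  pad : Infix _≡_ (true ∷ f) (P ++ a ∷ M ++ b ∷ N) → Infix _≡_ (true ∷ f) _
  pad i = subst (Infix _≡_ _) (sym padded) (0^ o ++ⁱ i)

  unpad : Infix _≡_ (true ∷ f) _ → Infix _≡_ (true ∷ f) (P ++ a ∷ M ++ b ∷ N)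
  unpad i = skip-zeros o (subst (Infix _≡_ _) padded i)

  rearrange : ∀ o p q → o + p + q ≡ p + q + o
  rearrange = solve-∀

  dimension : length (0^ o ++ P) + suc (length M + suc (length N))
              ≡ length P + suc (length M + suc (length N)) + o
  dimension = trans
    (cong (_+ _) (trans (length-++ (0^ o)) (cong (_+ length P) (length-replicate o))))
    (rearrange o (length P) _)

replicate-+ : ∀ m n {x : A} → replicate (m + n) x ≡ replicate m x ++ replicate n x
replicate-+ zero    n = refl
replicate-+ (suc m) n = cong (_ ∷_) (replicate-+ m n)

replicate-shift : ∀ n {x : A} xs → replicate n x ++ x ∷ xs ≡ x ∷ replicate n x ++ xs
replicate-shift zero    xs = refl
replicate-shift (suc n) xs = cong (_ ∷_) (replicate-shift n xs)

-- Levi's lemma; equal cuts fall under the first alternative, with `v` empty.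
++-split : ∀ (xs : List A) {ys} zs {ws} → xs ++ ys ≡ zs ++ ws →
           (∃[ v ] zs ≡ xs ++ v × ys ≡ v ++ ws) ⊎
           (∃₂ λ c v → xs ≡ zs ++ c ∷ v × c ∷ v ++ ys ≡ ws)
++-split []       zs       eq = inj₁ (zs , refl , eq)
++-split (x ∷ xs) []       eq = inj₂ (x , xs , refl , eq)
++-split (x ∷ xs) (z ∷ zs) eq with ∷-injective eq
... | refl , eq′ with ++-split xs zs eq′
...   | inj₁ (v , p , q)     = inj₁ (v , cong (x ∷_) p , q)
...   | inj₂ (c , v , p , q) = inj₂ (c , v , cong (x ∷_) p , q)

same-position : ∀ (xs ys : List A) {x y us vs} → length xs ≡ length ys →
                xs ++ x ∷ us ≡ ys ++ y ∷ vs → x ≡ y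
same-position []       []       _  eq = ∷-injectiveˡ eq
same-position (_ ∷ xs) (_ ∷ ys) ∣≡∣ eq =
  same-position xs ys (suc-injective ∣≡∣) (∷-injectiveʳ eq)

Prefix-++ : ∀ (xs ys : List A) → Prefix _≡_ xs (xs ++ ys)
Prefix-++ []       ys = []
Prefix-++ (x ∷ xs) ys = refl ∷ Prefix-++ xs ys

Prefix-refl : {xs : List A} → Prefix _≡_ xs xs
Prefix-refl = fromPointwise (≡⇒Pointwise-≡ refl)

Prefix-cancel : ∀ (us : List A) {xs ys} → Prefix _≡_ (us ++ xs) (us ++ ys) → Prefix _≡_ xs ys
Prefix-cancel []       p       = p
Prefix-cancel (_ ∷ us) (_ ∷ p) = Prefix-cancel us p

Infix⇒++ : ∀ {xs ys : List A} → Infix _≡_ xs ys → ∃₂ λ p s → ys ≡ p ++ xs ++ s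
Infix⇒++ i with MkView p eq s ← toView i =
  p , s , cong (λ u → p ++ u ++ s) (sym (Pointwise-≡⇒≡ eq))

-- An occurrence away from the front cannot start in the zeros, so it starts at the second displayed
-- 1 or later. Then `u` is the stretch strictly between that displayed 1 and the second 1 of the
-- occurrence.
occurrence : ∀ k → Infix _≡_ (true ∷ 0^ k ++ true ∷ g) (true ∷ 0^ k ++ true ∷ R) →
  Prefix _≡_ g R ⊎
  (∃[ p ] ∃₂ λ u s → true ∷ u ≡ p ++ true ∷ 0^ k × R ≡ u ++ true ∷ g ++ s)
occurrence k (here (_ ∷ p)) with _ ∷ p′ ← Prefix-cancel (0^ k) p = inj₁ p′
occurrence {g} {R} k (there i) with p , s , eq ← Infix⇒++ (skip-zeros k i) =
  inj₂ (p , nonempty p (trans eq (cong (λ u → p ++ true ∷ u) (++-assoc (0^ k) (true ∷ g) s))))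
  where
  nonempty : ∀ p → true ∷ R ≡ p ++ true ∷ 0^ k ++ true ∷ g ++ s →
             ∃₂ λ u s → true ∷ u ≡ p ++ true ∷ 0^ k × R ≡ u ++ true ∷ g ++ s
  nonempty []      refl = 0^ k , s , refl , refl
  nonempty (_ ∷ p) refl = p ++ true ∷ 0^ k , s , refl , sym (++-assoc p (true ∷ 0^ k) _)

zeros? : ∀ t → (∃[ j ] t ≡ 0^ j) ⊎ (∃₂ λ i r → t ≡ 0^ i ++ true ∷ r)
zeros? []         = inj₁ (0 , refl)
zeros? (true ∷ t) = inj₂ (0 , t , refl)
zeros? (false ∷ t) with zeros? t
... | inj₁ (j , refl)     = inj₁ (suc j , refl)
... | inj₂ (i , r , refl) = inj₂ (suc i , r , refl)

-- The leftmost 1 has index `i` on one side and `suc k + i` on the other.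
zeros-shift : ∀ k i {r s} → 0^ i ++ true ∷ s ≢ 0^ suc k ++ 0^ i ++ true ∷ r
zeros-shift k (suc i) {r} eq =
  zeros-shift k i (trans (∷-injectiveʳ eq) (replicate-shift k (0^ i ++ true ∷ r)))

-- Critical words when `t` contains a one

module Generic (k : ℕ) (t : List Bool) where

  private
    -- `K` is `h` without its final 0. With a = 0 the stretch `t a 0^k` is `K`, so `b` faces the
    -- final letter of `h` when `F` is laid at the front of the word.
    K h : List Bool
    K = t ++ 0^ suc k
    h = K ∷ʳ false

    P : List Bool
    P = true ∷ 0^ k ++ true ∷ t

    w : Bool → Bool → List Bool
    w a b = P ++ a ∷ 0^ k ++ b ∷ h

    F : List Bool
    F = true ∷ 0^ k ++ true ∷ h

    w≡ : ∀ a b → w a b ≡ true ∷ 0^ k ++ true ∷ t ++ a ∷ 0^ k ++ b ∷ h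
    w≡ a b = cong (true ∷_) (++-assoc (0^ k) (true ∷ t) _)

    K≡ : ∀ X → t ++ false ∷ 0^ k ++ X ≡ K ++ X
    K≡ X = sym (++-assoc t (0^ suc k) X)

    w0≡ : ∀ b → w false b ≡ true ∷ 0^ k ++ true ∷ K ++ b ∷ h
    w0≡ b = trans (w≡ false b) (cong (λ u → true ∷ 0^ k ++ true ∷ u) (K≡ (b ∷ h)))

    h++ : ∀ s → h ++ s ≡ K ++ false ∷ s
    h++ s = ++-assoc K (false ∷ []) s

    -- Since `K 0` is `h`, the word is `F` followed by `h`.
    F∈00 : Infix _≡_ F (w false false)
    F∈00 = here (subst (Prefix _≡_ F) (trans assoc (sym (w0≡ false))) (Prefix-++ F h))
      where
      assoc : F ++ h ≡ true ∷ 0^ k ++ true ∷ K ++ false ∷ h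
      assoc = cong (true ∷_) (trans (++-assoc (0^ k) (true ∷ h) h)
                (cong (λ u → 0^ k ++ true ∷ u) (h++ h)))

    F∈11 : Infix _≡_ F (w true true)
    F∈11 = P ++ⁱ here Prefix-refl

    too-long : ¬ Infix _≡_ (true ∷ h) h
    too-long = 1+n≰n ∘ length-mono

    ++⇒Infix : ∀ {xs ys} p s → ys ≡ p ++ xs ++ s → Infix {A = Bool} _≡_ xs ys
    ++⇒Infix {xs} p s refl = p ++ⁱ here (Prefix-++ xs s)

    suffix-long : ∀ v {s} → h ≢ v ++ true ∷ h ++ s
    suffix-long v eq = too-long (++⇒Infix v _ eq)

  -- At the front, the final 0 of `F` would meet b = 1. Any other occurrence is classified by where
  -- its second 1 lies relative to `b`.
  avoids-01 : ¬ Infix _≡_ F (w false true)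
  avoids-01 i with occurrence k (subst (Infix _≡_ F) (w0≡ true) i)
  ... | inj₁ p with () ∷ _ ← Prefix-cancel K p
  ... | inj₂ (p , u , s , 1u≡ , eq) with ++-split K u eq
  -- The second 1 of `F` lies on `b`, so its first 1, `suc k` places earlier, would lie on a = 0.
  ...   | inj₁ ([] , refl , _) = contradiction (∷ʳ-injectiveʳ (true ∷ t) p ends) λ ()
    where
    ends : (true ∷ t) ∷ʳ false ≡ p ∷ʳ true
    ends = ++-cancelʳ (0^ k) _ _ (begin
      (true ∷ t ++ false ∷ []) ++ 0^ k ≡⟨ ++-assoc (true ∷ t) (false ∷ []) (0^ k) ⟩
      true ∷ K                        ≡⟨ cong (true ∷_) (++-identityʳ K) ⟨
      true ∷ K ++ []                  ≡⟨ 1u≡ ⟩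
      p ++ true ∷ 0^ k                ≡⟨ ++-assoc p (true ∷ []) (0^ k) ⟨
      p ∷ʳ true ++ 0^ k               ∎)
      where open ≡-Reasoning
  -- Behind `b` only `h` is left, which is too short for `1 h`.
  ...   | inj₁ (_ ∷ v , _ , eq′) = suffix-long v (∷-injectiveʳ eq′)
  -- The second 1 lies inside `K`, say K = u 1 v. The copy of this 1 in the trailing `h` comes |h|
  -- places later, just where the occurrence has its final 0.
  ...   | inj₂ (c , v , K≡ucv , eq′) with refl , eq″ ← ∷-injective eq′ =
    contradiction (same-position (v ++ true ∷ u) K lengths mismatch) λ ()
    where
    open ≡-Reasoning
    mismatch : (v ++ true ∷ u) ++ true ∷ v ∷ʳ false ≡ K ++ false ∷ s
    mismatch = begin
      (v ++ true ∷ u) ++ true ∷ v ∷ʳ false ≡⟨ ++-assoc v (true ∷ u) _ ⟩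
      v ++ true ∷ u ++ true ∷ v ∷ʳ false   ≡⟨ cong (λ x → v ++ true ∷ x) (++-assoc u (true ∷ v) _) ⟨
      v ++ true ∷ (u ++ true ∷ v) ∷ʳ false ≡⟨ cong (λ x → v ++ true ∷ x ∷ʳ false) K≡ucv ⟨
      v ++ true ∷ h                        ≡⟨ eq″ ⟩
      h ++ s                               ≡⟨ h++ s ⟩
      K ++ false ∷ s                       ∎
    lengths : length (v ++ true ∷ u) ≡ length K
    lengths = begin
      length (v ++ true ∷ u)      ≡⟨ length-++ v ⟩
      length v + suc (length u)   ≡⟨ swap (length v) (length u) ⟩
      length u + suc (length v)   ≡⟨ length-++ u ⟨
      length (u ++ true ∷ v)      ≡⟨ cong length K≡ucv ⟨
      length K                    ∎
      where
      swap : ∀ m n → m + suc n ≡ n + suc m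
      swap = solve-∀

  -- At the front, the first 0 after `t` in `h` would meet a = 1. Any other occurrence is classified
  -- by where its second 1 lies relative to `a`.
  avoids-10 : ∀ i r → t ≡ 0^ i ++ true ∷ r → ¬ Infix _≡_ F (w true false)
  avoids-10 i r t≡ j with occurrence k (subst (Infix _≡_ F) (w≡ true false) j)
  ... | inj₁ p with () ∷ _ ← Prefix-cancel t {ys = true ∷ 0^ k ++ false ∷ h}
                              (subst (λ x → Prefix _≡_ x (t ++ true ∷ 0^ k ++ false ∷ h))
                                (++-assoc t (0^ suc k) (false ∷ [])) p)
  ... | inj₂ (_ , u , s , _ , eq) with ++-split t u eq
  -- The second 1 lies on `a`, so `h` is a prefix of `0^(k+1) h`. The 1 contained in `t` gives `h` a
  -- leftmost 1, which the shift would move.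
  ...   | inj₁ ([] , _ , eq′) = zeros-shift k i (begin
      0^ i ++ true ∷ r ++ 0^ suc k ∷ʳ false ++ s  ≡⟨ expand s ⟨
      h ++ s                                     ≡⟨ ∷-injectiveʳ eq′ ⟨
      0^ k ++ false ∷ h                          ≡⟨ replicate-shift k h ⟩
      0^ suc k ++ h                              ≡⟨ cong (0^ suc k ++_) (++-identityʳ h) ⟨
      0^ suc k ++ h ++ []                        ≡⟨ cong (0^ suc k ++_) (expand []) ⟩
      0^ suc k ++ 0^ i ++ true ∷ r ++ 0^ suc k ∷ʳ false ++ [] ∎)
    where
    open ≡-Reasoning
    expand : ∀ s → h ++ s ≡ 0^ i ++ true ∷ r ++ 0^ suc k ∷ʳ false ++ s
    expand s = begin
      (t ++ 0^ suc k) ∷ʳ false ++ s                ≡⟨ cong (_++ s) (++-assoc t (0^ suc k) (false ∷ [])) ⟩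
      (t ++ 0^ suc k ∷ʳ false) ++ s                ≡⟨ ++-assoc t (0^ suc k ∷ʳ false) s ⟩
      t ++ 0^ suc k ∷ʳ false ++ s                  ≡⟨ cong (_++ 0^ suc k ∷ʳ false ++ s) t≡ ⟩
      (0^ i ++ true ∷ r) ++ 0^ suc k ∷ʳ false ++ s ≡⟨ ++-assoc (0^ i) (true ∷ r) _ ⟩
      0^ i ++ true ∷ r ++ 0^ suc k ∷ʳ false ++ s   ∎
  -- Behind `a` stands `0^(k+1) h`: the zeros offer no start for `1 h`, and `h` is too short.
  ...   | inj₁ (_ ∷ v , _ , eq′) =
    too-long (skip-zeros (suc k)
      (subst (Infix _≡_ _) (replicate-shift k h) (++⇒Infix v s (∷-injectiveʳ eq′))))
  -- The second 1 lies inside `t`, say t = u 1 v. Because |h| = |t| + k + 2, its copy in the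
  -- trailing `h` again meets the final 0 of the occurrence.
  ...   | inj₂ (c , v , t≡ucv , eq′) with refl , eq″ ← ∷-injective eq′ =
    contradiction (same-position (v ++ true ∷ 0^ suc k ++ u) K lengths mismatch) λ ()
    where
    open ≡-Reasoning
    tail : List Bool
    tail = v ++ 0^ suc k ∷ʳ false
    h≡ : h ≡ u ++ true ∷ tail
    h≡ = begin
      (t ++ 0^ suc k) ∷ʳ false          ≡⟨ ++-assoc t (0^ suc k) (false ∷ []) ⟩
      t ++ 0^ suc k ∷ʳ false            ≡⟨ cong (_++ 0^ suc k ∷ʳ false) t≡ucv ⟩
      (u ++ true ∷ v) ++ 0^ suc k ∷ʳ false ≡⟨ ++-assoc u (true ∷ v) _ ⟩
      u ++ true ∷ tail                  ∎
    mismatch : (v ++ true ∷ 0^ suc k ++ u) ++ true ∷ tail ≡ K ++ false ∷ s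
    mismatch = begin
      (v ++ true ∷ 0^ suc k ++ u) ++ true ∷ tail ≡⟨ ++-assoc v (true ∷ 0^ suc k ++ u) _ ⟩
      v ++ true ∷ (0^ suc k ++ u) ++ true ∷ tail ≡⟨ cong (λ x → v ++ true ∷ x) (++-assoc (0^ suc k) u _) ⟩
      v ++ true ∷ 0^ suc k ++ u ++ true ∷ tail ≡⟨ cong (λ x → v ++ true ∷ 0^ suc k ++ x) h≡ ⟨
      v ++ true ∷ 0^ suc k ++ h                ≡⟨ cong (λ x → v ++ true ∷ x) (replicate-shift k h) ⟨
      v ++ true ∷ 0^ k ++ false ∷ h            ≡⟨ eq″ ⟩
      h ++ s                                   ≡⟨ h++ s ⟩
      K ++ false ∷ s                           ∎
    lengths : length (v ++ true ∷ 0^ suc k ++ u) ≡ length K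
    lengths = begin
      length (v ++ true ∷ 0^ suc k ++ u)                    ≡⟨ length-++ v ⟩
      length v + suc (length (0^ suc k ++ u))               ≡⟨ cong (λ n → length v + suc n) (length-++ (0^ suc k)) ⟩
      length v + suc (length (0^ suc k) + length u)         ≡⟨ rotate (length v) (length (0^ suc k)) (length u) ⟩
      length u + suc (length v) + length (0^ suc k)         ≡⟨ cong (_+ length (0^ suc k)) (length-++ u) ⟨
      length (u ++ true ∷ v) + length (0^ suc k)            ≡⟨ cong (λ x → length x + length (0^ suc k)) t≡ucv ⟨
      length t + length (0^ suc k)                          ≡⟨ length-++ t ⟨
      length K                                              ∎
      where
      rotate : ∀ m n o → m + suc (n + o) ≡ o + suc m + n
      rotate = solve-∀

  -- The bound on `d` is exactly the length of `w a b`.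
  not-isometric : ∀ i r → t ≡ 0^ i ++ true ∷ r →
                  2 * suc (length h) + k ≤ d → ¬ Isometric (Q[ F ]⊑Q d)
  not-isometric {d} i r t≡ ≤d = critical-pair P (0^ k) h F∈00 F∈11 (avoids-10 i r t≡) avoids-01
    (subst (_≤ d) (sym total) ≤d)
    where
    open ≡-Reasoning
    ∣P∣ : length P ≡ suc (k + suc (length t))
    ∣P∣ = cong suc (trans (length-++ (0^ k)) (cong (_+ _) (length-replicate k)))
    ∣h∣ : length h ≡ length t + suc k + 1
    ∣h∣ = trans (length-++ K) (cong (_+ 1) (trans (length-++ t)
            (cong (length t +_) (length-replicate (suc k)))))
    arith : ∀ k t h → suc (k + suc t) + suc (k + suc h) ≡ (t + suc k + 1) + h + 2 + k
    arith = solve-∀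
    double : ∀ h k → h + h + 2 + k ≡ 2 * suc h + k
    double = solve-∀
    total : length P + suc (length (0^ k) + suc (length h)) ≡ 2 * suc (length h) + k
    total = begin
      length P + suc (length (0^ k) + suc (length h))
        ≡⟨ cong₂ (λ p m → p + suc (m + suc (length h))) ∣P∣ (length-replicate k) ⟩
      suc (k + suc (length t)) + suc (k + suc (length h))
        ≡⟨ arith k (length t) (length h) ⟩
      (length t + suc k + 1) + length h + 2 + k
        ≡⟨ cong (λ n → n + length h + 2 + k) ∣h∣ ⟨
      length h + length h + 2 + k
        ≡⟨ double (length h) k ⟩
      2 * suc (length h) + k ∎

-- Critical words when `t` is a zero word

module Zeros (k j : ℕ) where

  private
    -- The 0 singled out after `2 + k` zeros is the letter that faces `b` when `F` is laid at the
    -- front of `w a b`. The run between the first two ones of `F` is `suc k`, hence nonempty.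
    h : List Bool
    h = 0^ (2 + k) ++ false ∷ 0^ j

    P : List Bool
    P = true ∷ 0^ suc k ++ true ∷ []

    w : Bool → Bool → List Bool
    w a b = P ++ a ∷ 0^ suc k ++ b ∷ h

    F : List Bool
    F = true ∷ 0^ suc k ++ true ∷ h

    w≡ : ∀ a b → w a b ≡ true ∷ 0^ suc k ++ true ∷ a ∷ 0^ suc k ++ b ∷ h
    w≡ a b = cong (true ∷_) (++-assoc (0^ suc k) (true ∷ []) _)

    ∣h∣ : length h ≡ 2 + k + suc j
    ∣h∣ = trans (length-++ (0^ (2 + k)))
            (cong₂ (λ m n → m + suc n) (length-replicate (2 + k)) (length-replicate j))

    F∈00 : Infix _≡_ F (w false false)
    F∈00 = here (subst (Prefix _≡_ F) (trans assoc (sym (w≡ false false))) (Prefix-++ F (0^ (3 + k))))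
      where
      open ≡-Reasoning
      h≡ : h ≡ 0^ (2 + k + suc j)
      h≡ = sym (replicate-+ (2 + k) (suc j))
      zeros : h ++ 0^ (3 + k) ≡ 0^ (2 + k) ++ false ∷ h
      zeros = begin
        h ++ 0^ (3 + k)                     ≡⟨ cong (_++ 0^ (3 + k)) h≡ ⟩
        0^ (2 + k + suc j) ++ 0^ (3 + k)    ≡⟨ replicate-+ (2 + k + suc j) (3 + k) ⟨
        0^ (2 + k + suc j + (3 + k))        ≡⟨ cong 0^_ (arith k j) ⟩
        0^ (2 + k + suc (2 + k + suc j))    ≡⟨ replicate-+ (2 + k) (suc (2 + k + suc j)) ⟩
        0^ (2 + k) ++ false ∷ 0^ (2 + k + suc j) ≡⟨ cong (λ x → 0^ (2 + k) ++ false ∷ x) h≡ ⟨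
        0^ (2 + k) ++ false ∷ h             ∎
        where
        arith : ∀ k j → 2 + k + suc j + (3 + k) ≡ 2 + k + suc (2 + k + suc j)
        arith = solve-∀
      assoc : F ++ 0^ (3 + k) ≡ true ∷ 0^ suc k ++ true ∷ 0^ (2 + k) ++ false ∷ h
      assoc = cong (true ∷_) (trans (++-assoc (0^ suc k) (true ∷ h) _)
                (cong (λ x → 0^ suc k ++ true ∷ x) zeros))

    F∈11 : Infix _≡_ F (w true true)
    F∈11 = P ++ⁱ here Prefix-refl

  -- Only the three ones of the word are possible starts. From the first, `h` would begin with 1;
  -- from the second, a 1 meets the nonempty zero run of `F`; from the third, the second 1 of `F`
  -- meets b = 0.
  avoids-10 : ¬ Infix _≡_ F (w true false)
  avoids-10 i with subst (Infix _≡_ F) (w≡ true false) i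
  ... | here (_ ∷ p) with _ ∷ () ∷ _ ← Prefix-cancel (0^ suc k) p
  ... | there i₁ with skip-zeros (suc k) i₁
  ...   | here (_ ∷ () ∷ _)
  ...   | there (here (_ ∷ p)) with () ∷ _ ← Prefix-cancel (0^ suc k) p
  ...   | there (there i₂) with skip-zeros (suc k) i₂
  ...     | i₃ with skip-zeros (3 + k) i₃
  ...       | i₄ with skip-zeros (suc j) (subst (Infix _≡_ F) (sym (++-identityʳ (0^ suc j))) i₄)
  ...         | here ()

  -- From the first 1, a zero of `h` meets b = 1. From the second, `2 + k` zeros follow where `F`
  -- has only `suc k` before its next 1. From the third on, too few letters remain.
  avoids-01 : ¬ Infix _≡_ F (w false true)
  avoids-01 i with subst (Infix _≡_ F) (w≡ false true) i
  ... | here (_ ∷ p) with _ ∷ p′ ← Prefix-cancel (0^ suc k) p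
                     with () ∷ _ ← Prefix-cancel (0^ (2 + k)) p′
  ... | there i₁ with skip-zeros (suc k) i₁
  ...   | here (_ ∷ p) with () ∷ _ ← Prefix-cancel (0^ suc k)
                              (subst (Prefix _≡_ _) (sym (replicate-shift (suc k) _)) p)
  ...   | there i₂ with skip-zeros (suc (suc k)) i₂
  ...     | i₃ = <⇒≱ (s≤s long) (length-mono i₃)
    where
    long : suc (length h) ≤ length (0^ suc k ++ true ∷ h)
    long = ≤-trans (m≤n+m _ (length (0^ suc k))) (≤-reflexive (sym (length-++ (0^ suc k))))

  -- Here `w a b` is shorter than the bound by `j`, the number of zeros of `h` beyond the required
  -- `3 + k`.
  not-isometric : 2 * suc (length h) + suc k ≤ d → ¬ Isometric (Q[ F ]⊑Q d)
  not-isometric ≤d = critical-pair P (0^ suc k) h F∈00 F∈11 avoids-10 avoids-01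
    (≤-trans (≤-trans (m≤m+n _ j) (≤-reflexive total)) ≤d)
    where
    open ≡-Reasoning
    arith : ∀ k j h → suc (suc k + 1) + suc (suc k + suc h) + j ≡ (2 + k + suc j) + h + 2 + suc k
    arith = solve-∀
    double : ∀ h k → h + h + 2 + k ≡ 2 * suc h + k
    double = solve-∀
    total : length P + suc (length (0^ suc k) + suc (length h)) + j ≡ 2 * suc (length h) + suc k
    total = begin
      length P + suc (length (0^ suc k) + suc (length h)) + j
        ≡⟨ cong₂ (λ p m → p + suc (m + suc (length h)) + j)
             (cong suc (trans (length-++ (0^ suc k)) (cong (_+ 1) (length-replicate (suc k)))))
             (length-replicate (suc k)) ⟩
      suc (suc k + 1) + suc (suc k + suc (length h)) + j
        ≡⟨ arith k j (length h) ⟩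
      (2 + k + suc j) + length h + 2 + suc k
        ≡⟨ cong (λ n → n + length h + 2 + suc k) ∣h∣ ⟨
      length h + length h + 2 + suc k
        ≡⟨ double (length h) (suc k) ⟩
      2 * suc (length h) + suc k ∎

-- Joining the two cases

not-isometric : ∀ k t → let h = (t ++ 0^ (2 + k)) ∷ʳ false in
  2 * suc (length h) + suc k ≤ d → ¬ Isometric (Q[ true ∷ 0^ suc k ++ true ∷ h ]⊑Q d)
not-isometric {d} k t ≤d with zeros? t
... | inj₂ (i , r , t≡) = Generic.not-isometric (suc k) t i r t≡ ≤d
... | inj₁ (j , refl) =
  subst (λ h → 2 * suc (length h) + suc k ≤ d → ¬ Isometric (Q[ true ∷ 0^ suc k ++ true ∷ h ]⊑Q d))
    h≡ (Zeros.not-isometric k j) ≤d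
  where
  open ≡-Reasoning
  arith : ∀ k j → 2 + k + suc j ≡ j + (2 + k) + 1
  arith = solve-∀
  h≡ : 0^ (2 + k) ++ false ∷ 0^ j ≡ (0^ j ++ 0^ (2 + k)) ∷ʳ false
  h≡ = begin
    0^ (2 + k) ++ 0^ suc j       ≡⟨ replicate-+ (2 + k) (suc j) ⟨
    0^ (2 + k + suc j)           ≡⟨ cong 0^_ (arith k j) ⟩
    0^ (j + (2 + k) + 1)         ≡⟨ replicate-+ (j + (2 + k)) 1 ⟩
    0^ (j + (2 + k)) ∷ʳ false    ≡⟨ cong (_∷ʳ false) (replicate-+ j (2 + k)) ⟩
    (0^ j ++ 0^ (2 + k)) ∷ʳ false ∎

-- Block words

blocks-end : ∀ m (x y : Fin (suc m) → ℕ) → ∃[ p ] blocks x y ≡ p ++ 0^ y (fromℕ m)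
blocks-end zero    x y = replicate (x zero) true , ++-identityʳ _
blocks-end (suc m) x y with p , eq ← blocks-end m (x ∘ suc) (y ∘ suc) =
  first ++ p , trans (cong (first ++_) eq) (sym (++-assoc first p _))
  where
  first : List Bool
  first = replicate (x zero) true ++ 0^ y zero

blocks-start : ∀ {m} (x y : Fin (suc m) → ℕ) → x zero ≥ 1 → ∃[ r ] blocks x y ≡ true ∷ r
blocks-start x y x≥1 with x zero | x≥1
... | suc _ | _ = _ , refl

length-blocks : ∀ m (x y : Fin m → ℕ) → length (blocks x y) ≡ sum (tabulate λ i → x i + y i)
length-blocks zero    x y = refl
length-blocks (suc m) x y = begin
  length (first ++ blocks (x ∘ suc) (y ∘ suc))
    ≡⟨ length-++ first ⟩
  length first + length (blocks (x ∘ suc) (y ∘ suc))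
    ≡⟨ cong₂ _+_ (length-++ (replicate (x zero) true)) (length-blocks m (x ∘ suc) (y ∘ suc)) ⟩
  length (replicate (x zero) true) + length (0^ y zero) + rest
    ≡⟨ cong₂ (λ m n → m + n + rest) (length-replicate (x zero)) (length-replicate (y zero)) ⟩
  x zero + y zero + rest ∎
  where
  open ≡-Reasoning
  rest : ℕ
  rest = sum (tabulate λ i → x (suc i) + y (suc i))
  first : List Bool
  first = replicate (x zero) true ++ 0^ y zero

-- Surplus zeros of the final run are moved into the part before it. That part is nonempty because
-- `g` starts with 1, so this 1 can be split off.
trim-zeros : ∀ k n {g r p} → n ≥ suc k → g ≡ true ∷ r → g ≡ p ++ 0^ n →
             ∃[ t ] g ≡ true ∷ (t ++ 0^ k) ∷ʳ false
trim-zeros k n {p = p} n>k refl g≡ with o , refl ← m≤n⇒∃[o]m+o≡n n>k = go k (p ++ 0^ o) (begin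
    true ∷ _                          ≡⟨ g≡ ⟩
    p ++ 0^ (suc k + o)               ≡⟨ cong (λ n → p ++ 0^ n) (arith k o) ⟩
    p ++ 0^ (o + (k + 1))             ≡⟨ cong (p ++_) (replicate-+ o (k + 1)) ⟩
    p ++ 0^ o ++ 0^ (k + 1)           ≡⟨ ++-assoc p (0^ o) _ ⟨
    (p ++ 0^ o) ++ 0^ (k + 1)         ≡⟨ cong ((p ++ 0^ o) ++_) (replicate-+ k 1) ⟩
    (p ++ 0^ o) ++ 0^ k ∷ʳ false      ≡⟨ ++-assoc (p ++ 0^ o) (0^ k) _ ⟨
    ((p ++ 0^ o) ++ 0^ k) ∷ʳ false    ∎)
  where
  open ≡-Reasoning
  arith : ∀ k o → suc k + o ≡ o + (k + 1)
  arith = solve-∀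
  go : ∀ k q {r} → true ∷ r ≡ (q ++ 0^ k) ∷ʳ false → ∃[ t ] true ∷ r ≡ true ∷ (t ++ 0^ k) ∷ʳ false
  go zero    []      ()
  go (suc _) []      ()
  go k       (_ ∷ t) eq with refl , eq′ ← ∷-injective eq = t , eq

not-isometric-blocks : ∀ {x y n g r p} → x ≡ 1 → y ≥ 1 → n ≥ y + 2 →
  g ≡ true ∷ r → g ≡ p ++ 0^ n → 2 * length g + y ≤ d →
  ¬ Isometric (Q[ (replicate x true ++ 0^ y) ++ g ]⊑Q d)
not-isometric-blocks {y = suc k} {n} refl _ n≥ start end ≤d
  -- With y = `suc k`, the y + 2 guaranteed zeros are `2 + k` and one last zero. Thus `g` is `1 h`,
  -- of length `suc (length h)`.
  with t , refl ← trim-zeros (2 + k) n (subst (_≤ n) (+-comm (suc k) 2) n≥) start end =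
  not-isometric k t ≤d

lemma2p2 : (m : ℕ) (x y : Fin (2 + m) → ℕ) →
    (∀ i → x i ≥ 1) → (∀ i → y i ≥ 1) →
    x zero ≡ 1 →
    y (fromℕ (suc m)) ≥ y zero + 2 →
    (d : ℕ) → d ≥ 2 * sum (tabulate λ i → x (suc i) + y (suc i)) + y zero →
    ¬ Isometric (Q[ blocks x y ]⊑Q d)
lemma2p2 m x y x≥1 y≥1 x₀≡1 y-last d ≤d =
  -- The word is cut after its first block `1 0^y`; the remaining blocks form `g`, whose length is
  -- the sum in the bound.
  not-isometric-blocks x₀≡1 (y≥1 zero) y-last
    (proj₂ (blocks-start (x ∘ suc) (y ∘ suc) (x≥1 (suc zero))))
    (proj₂ (blocks-end m (x ∘ suc) (y ∘ suc)))
    (subst (λ n → 2 * n + y zero ≤ d) (sym (length-blocks _ (x ∘ suc) (y ∘ suc))) ≤d)
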